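{- Let $\Sigma$ and $\Gamma$ be finite alphabets and let $w,w'\in(\Sigma\cap\Gamma)^*$. Then $w$ and $w'$ are strongly $M$-equivalent with respect to $\Sigma$ if and only if they are strongly $M$-equivalent with respect to $\Gamma$.
   Context: Parikh matrices: for an ordered alphabet $\Delta=\{a_1<a_2<\dots<a_s\}$, the Parikh matrix mapping $\Psi_\Delta:\Delta^*\to\mathcal M_{s+1}$ is the monoid morphism into the multiplicative monoid of $(s+1)\times(s+1)$ upper triangular matrices with nonnegative integer entries and unit diagonal that sends $a_q$ to the matrix with $1$'s on the diagonal, $1$ in position $(q,q+1)$, and $0$ elsewhere. Two words are $M$-equivalent with respect to $\Delta$ iff they have the same image under $\Psi_\Delta$. Strong $M$-equivalence: for an (unordered) alphabet $\Sigma$, words $w,w'\in\Sigma^*$ are strongly $M$-equivalent with respect to $\Sigma$ iff they are $M$-equivalent with respect to every ordered alphabet whose underlying set is $\Sigma$. -}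

module Defs where

open import Data.Bool.Base using (if_then_else_; _∧_; _∨_)
open import Data.Fin.Base using (Fin; inject₁) renaming (suc to fsuc)
open import Data.Fin.Properties using (_≟_)
open import Data.List.Base using (List; []; _∷_; map)
open import Data.Nat.Base using (ℕ; suc; _*_)
open import Data.Nat.Properties using (+-*-semiring)
open import Data.Product.Base using (∃; _×_; _,_; proj₂; map₂)
open import Data.Vec.Functional using (Vector)
open import Function.Definitions using (Injective)
open import Level using (Level)
open import Relation.Binary.PropositionalEquality.Core using (_≡_)
open import Relation.Nullary.Decidable.Core using (does)
open import Relation.Unary using (Pred; _⊆_; _≐_)
open import Algebra.Properties.Semiring.Sum +-*-semiring using (sum)

private
  variable
    a ℓ ℓ₁ ℓ₂ : Level
    A : Set a
    n : ℕ

Matrix : ℕ → Set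
Matrix n = Vector (Vector ℕ n) n

infix  4 _≋_
infixl 7 _⊗_

_≋_ : Matrix n → Matrix n → Set
M ≋ N = ∀ i j → M i j ≡ N i j

identity : Matrix n
identity i j = if does (i ≟ j) then 1 else 0

_⊗_ : Matrix n → Matrix n → Matrix n
(M ⊗ N) i j = sum (λ k → M i k * N k j)

-- The ordered alphabet a₁ < … < aₛ, given by its enumeration in increasing
-- order; position q : Fin s (counted from 0) holds the letter a_{q+1}.
record OrderedAlphabet (A : Set a) : Set a where
  field
    size             : ℕ
    letter           : Fin size → A
    letter-injective : Injective _≡_ _≡_ letter

  Underlying : Pred A a
  Underlying x = ∃ λ q → letter q ≡ x

open OrderedAlphabet public using (size; Underlying)

Finite : {A : Set a} → Pred A ℓ → Set _
Finite {A = A} P = ∃ λ (Δ : OrderedAlphabet A) → Underlying Δ ≐ P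

-- P *, the words all of whose letters lie in the alphabet P.
Word : {A : Set a} → Pred A ℓ → Set _
Word P = List (∃ P)

inclusion : {P : Pred A ℓ₁} {Q : Pred A ℓ₂} → P ⊆ Q → Word P → Word Q
inclusion P⊆Q = map (map₂ P⊆Q)

-- Since Fin counts from 0, the matrix position (q , q + 1) is
-- (inject₁ q , fsuc q).
letterMatrix : Fin n → Matrix (suc n)
letterMatrix q i j =
  if does (i ≟ j) ∨ (does (i ≟ inject₁ q) ∧ does (j ≟ fsuc q)) then 1 else 0

-- The free-monoid extension of letterMatrix.  Its values are upper triangular
-- with unit diagonal; this is not recorded in the type because equality in
-- that submonoid is equality of matrices.
parikhMatrix : (Δ : OrderedAlphabet A) → Word (Underlying Δ) → Matrix (suc (size Δ))
parikhMatrix Δ []                = identity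
parikhMatrix Δ ((_ , q , _) ∷ w) = letterMatrix q ⊗ parikhMatrix Δ w

MEquivalent : (Δ : OrderedAlphabet A) (w w′ : Word (Underlying Δ)) → Set
MEquivalent Δ w w′ = parikhMatrix Δ w ≋ parikhMatrix Δ w′

StronglyMEquivalent : {A : Set a} (P : Pred A ℓ) (w w′ : Word P) → Set _
StronglyMEquivalent {A = A} P w w′ =
  (Δ : OrderedAlphabet A) (Δ≐P : Underlying Δ ≐ P) →
  MEquivalent Δ (inclusion (proj₂ Δ≐P) w) (inclusion (proj₂ Δ≐P) w′)

{-# OPTIONS --safe #-}

-- The (i , j) entry of a Parikh matrix with respect to Δ counts the occurrences
-- of the segment of Δ between i and j as a scattered subword.  A segment
-- containing a letter that occurs in neither word contributes 0 on both sides;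
-- otherwise all its letters lie in the other alphabet, which can then be
-- ordered so that the segment comes first, and the two counts are entries of
-- the Parikh matrices for that order.  Since membership in Σ ∩ Γ need not be
-- decidable, the case distinction is on occurrence in the two given words.
module Submission where

open import Defs
open import Data.Bool.Base using (true; false; if_then_else_)
open import Data.Fin.Base using (Fin; zero; suc; inject₁; toℕ; _<_; _≤_)
open import Data.Fin.Properties using (_≟_; toℕ-inject₁; inject₁-injective; <⇒≢)
open import Data.List.Base using (List; []; _∷_; map; _++_; filter; allFin; length; lookup)
open import Data.List.Membership.Propositional using (_∈_; _∉_)
open import Data.List.Membership.Propositional.Properties
  using (∈-++⁺ˡ; ∈-++⁺ʳ; ∈-lookup; ∈-filter⁺; ∈-filter⁻; ∈-allFin)
open import Data.List.Properties using (map-∘; ∷-injective)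
open import Data.List.Relation.Binary.Pointwise using (Pointwise; []; _∷_; ++⁺)
open import Data.List.Relation.Unary.All as All using (All; []; _∷_; all?)
open import Data.List.Relation.Unary.All.Properties using (¬All⇒Any¬)
open import Data.List.Relation.Unary.AllPairs using ([]; _∷_)
open import Data.List.Relation.Unary.Any as Any using (here; there; index)
open import Data.List.Relation.Unary.Any.Properties using (lookup-index)
open import Data.List.Relation.Unary.Unique.Propositional using (Unique)
import Data.List.Relation.Unary.Unique.Propositional.Properties as Unique
open import Data.Nat.Base as ℕ using (ℕ; suc; _+_; _*_; s≤s; z≤n)
import Data.Nat.Properties as ℕ
open import Data.Product.Base using (∃; _×_; _,_; proj₁; proj₂)
open import Data.Sum.Base using (_⊎_; inj₁; inj₂)
open import Function.Base using (_∘_)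
open import Function.Bundles using (_⇔_; mk⇔)
open import Level using (Level)
open import Relation.Binary.Core using (REL)
open import Relation.Binary.PropositionalEquality
  using (_≡_; _≢_; refl; sym; trans; cong; cong₂; subst; module ≡-Reasoning)
open import Relation.Nullary.Decidable using (yes; no; does; ¬?; dec-true; dec-false)
open import Relation.Nullary.Negation using (contradiction)
open import Relation.Unary using (Pred; _∩_; _≐_; _⊆_)
open import Algebra.Properties.Semiring.Sum ℕ.+-*-semiring
  using (sum; sum-cong-≗; ∑-distrib-+; sum-replicate-zero)

open OrderedAlphabet using (letter; letter-injective)

private
  variable
    a ℓ ℓ₁ ℓ₂ ℓ₃ : Level
    A : Set a
    m n : ℕ

-- Left multiplication by a letter matrix.

δ : Fin n → Fin n → ℕ
δ i j = if does (i ≟ j) then 1 else 0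

sum-δ : (i : Fin n) (f : Fin n → ℕ) → sum (λ k → δ i k * f k) ≡ f i
sum-δ {suc n} zero    f = trans (cong₂ _+_ (ℕ.*-identityˡ (f zero)) (sum-replicate-zero n))
                                (ℕ.+-identityʳ (f zero))
sum-δ {suc n} (suc i) f = sum-δ i (f ∘ suc)

-- The position `(inject₁ q , suc q)` lies off the diagonal, so the disjunction defining the entry
-- becomes a sum: identity plus one matrix unit.
letterMatrix-split : (q : Fin n) (i k : Fin (suc n)) →
  letterMatrix q i k ≡ δ i k + (if does (i ≟ inject₁ q) then δ (suc q) k else 0)
letterMatrix-split q i k with i ≟ k | i ≟ inject₁ q
... | yes refl | no _     = refl
... | no _     | no _     = refl
... | yes refl | yes refl
  rewrite dec-false (suc q ≟ inject₁ q) (λ e → ℕ.1+n≢n (trans (cong toℕ e) (toℕ-inject₁ q))) = refl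
... | no _     | yes _    with k ≟ suc q
...   | yes refl rewrite dec-true (suc q ≟ suc q) refl = refl
...   | no k≢    rewrite dec-false (suc q ≟ k) (k≢ ∘ sym) = refl

-- A row operation: row `suc q` is added to row `inject₁ q`. This is what matches the recursion of
-- `occurrences` on the first letter of a word.
letterMatrix-⊗ : (q : Fin n) (M : Matrix (suc n)) (i j : Fin (suc n)) →
  (letterMatrix q ⊗ M) i j ≡ M i j + (if does (i ≟ inject₁ q) then M (suc q) j else 0)
letterMatrix-⊗ {n} q M i j = begin
  sum (λ k → letterMatrix q i k * M k j)
    ≡⟨ sum-cong-≗ (λ k → trans (cong (_* M k j) (letterMatrix-split q i k))
                               (ℕ.*-distribʳ-+ (M k j) (δ i k) (ε k))) ⟩
  sum (λ k → δ i k * M k j + ε k * M k j)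
    ≡⟨ ∑-distrib-+ (λ k → δ i k * M k j) (λ k → ε k * M k j) ⟩
  sum (λ k → δ i k * M k j) + sum (λ k → ε k * M k j)
    ≡⟨ cong₂ _+_ (sum-δ i (λ k → M k j)) sum-ε ⟩
  M i j + (if does (i ≟ inject₁ q) then M (suc q) j else 0) ∎
  where
  open ≡-Reasoning
  ε : Fin _ → ℕ
  ε k = if does (i ≟ inject₁ q) then δ (suc q) k else 0
  sum-ε : sum (λ k → ε k * M k j) ≡ (if does (i ≟ inject₁ q) then M (suc q) j else 0)
  sum-ε with does (i ≟ inject₁ q)
  ... | true  = sum-δ (suc q) (λ k → M k j)
  ... | false = sum-replicate-zero (suc n)

-- Counting scattered subwords.

-- The number of embeddings of the first word into the second as a scattered subword: the head of
-- the second is either skipped or matched with the head of the first.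
occurrences : List (Fin n) → List (Fin n) → ℕ
occurrences []      w       = 1
occurrences (x ∷ u) []      = 0
occurrences (x ∷ u) (y ∷ w) =
  occurrences (x ∷ u) w + (if does (x ≟ y) then occurrences u w else 0)

occurrences-absent : ∀ {x : Fin n} {u w} → x ∈ u → x ∉ w → occurrences u w ≡ 0
occurrences-absent {u = z ∷ u} {[]}    x∈u x∉w = refl
occurrences-absent {u = z ∷ u} {y ∷ w} x∈u x∉w
  rewrite occurrences-absent x∈u (x∉w ∘ there) with z ≟ y | x∈u
... | no _     | _           = refl
... | yes refl | here refl   = contradiction (here refl) x∉w
... | yes refl | there x∈u′  = occurrences-absent x∈u′ (x∉w ∘ there)

-- A partial bijection, given as a relation because a letter of one alphabet may have no counterpart
-- in the other.
BiUnique : REL (Fin m) (Fin n) ℓ → Set ℓ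
BiUnique R = ∀ {x x′ y y′} → R x x′ → R y y′ → (x ≡ y → x′ ≡ y′) × (x′ ≡ y′ → x ≡ y)

-- The count depends only on the outcomes of equality tests, and `BiUnique` makes these agree on
-- both sides.
occurrences-cong : {R : REL (Fin m) (Fin n) ℓ} → BiUnique R → ∀ {u u′ w w′} →
  Pointwise R u u′ → Pointwise R w w′ → occurrences u w ≡ occurrences u′ w′
occurrences-cong bi []       _  = refl
occurrences-cong bi (_ ∷ _)  [] = refl
occurrences-cong bi {x ∷ _} {x′ ∷ _} {y ∷ _} {y′ ∷ _} (xRx′ ∷ us) (yRy′ ∷ ws)
  rewrite occurrences-cong bi (xRx′ ∷ us) ws with x ≟ y | x′ ≟ y′
... | yes _   | yes _     = cong (_ +_) (occurrences-cong bi us ws)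
... | no _    | no _      = refl
... | yes x≡y | no x′≢y′  = contradiction (proj₁ (bi xRx′ yRy′) x≡y) x′≢y′
... | no x≢y  | yes x′≡y′ = contradiction (proj₂ (bi xRx′ yRy′) x′≡y′) x≢y

-- Segments of consecutive letters.

-- Segment i j u: the consecutive letters u = i , i + 1 , … , j − 1.
data Segment {n : ℕ} : Fin (suc n) → Fin (suc n) → List (Fin n) → Set where
  []  : ∀ {j} → Segment j j []
  _∷_ : ∀ q {j u} → Segment (suc q) j u → Segment (inject₁ q) j (q ∷ u)

Segment-suc : ∀ {i j : Fin (suc n)} {u} → Segment i j u → Segment (suc i) (suc j) (map suc u)
Segment-suc []      = []
Segment-suc (q ∷ s) = suc q ∷ Segment-suc s

segment? : (i j : Fin (suc n)) → ∃ (Segment i j) ⊎ j < i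
segment?         zero    zero    = inj₁ (_ , [])
segment? {suc n} zero    (suc j) with segment? zero j
-- Only this case arises, since nothing lies below `zero`.
... | inj₁ (_ , s) = inj₁ (_ , zero ∷ Segment-suc s)
segment? {suc n} (suc i) zero    = inj₂ (s≤s z≤n)
segment? {suc n} (suc i) (suc j) with segment? i j
... | inj₁ (_ , s) = inj₁ (_ , Segment-suc s)
... | inj₂ j<i     = inj₂ (s≤s j<i)

Segment-≤ : ∀ {i j : Fin (suc n)} {u} → Segment i j u → i ≤ j
Segment-≤ []      = ℕ.≤-refl
Segment-≤ (q ∷ s) = ℕ.≤-trans (ℕ.≤-reflexive (toℕ-inject₁ q)) (ℕ.<⇒≤ (Segment-≤ s))

Segment-< : ∀ {q : Fin n} {j u} → Segment (suc q) j u → inject₁ q < j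
Segment-< {q = q} s = ℕ.≤-trans (s≤s (ℕ.≤-reflexive (toℕ-inject₁ q))) (Segment-≤ s)

Segment-lower : ∀ {i j : Fin (suc n)} {u} → Segment i j u → All (λ q → toℕ i ℕ.≤ toℕ q) u
Segment-lower []      = []
Segment-lower (q ∷ s) =
  ℕ.≤-reflexive (toℕ-inject₁ q) ∷
  All.map (λ q<r → ℕ.≤-trans (ℕ.≤-reflexive (toℕ-inject₁ q)) (ℕ.<⇒≤ q<r)) (Segment-lower s)

Segment-unique : ∀ {i j : Fin (suc n)} {u} → Segment i j u → Unique u
Segment-unique []      = []
Segment-unique (q ∷ s) = All.map <⇒≢ (Segment-lower s) ∷ Segment-unique s

-- The list `u` consists of the first `length xs` positions, so it is a segment from `zero`, and
-- reading the concatenation along it returns `xs`.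
Segment-prefix : (xs ys : List A) →
  ∃ λ j → ∃ λ u → Segment {length (xs ++ ys)} zero j u ×
                  Pointwise (λ x p → x ≡ lookup (xs ++ ys) p) xs u
Segment-prefix []       ys = zero , [] , [] , []
Segment-prefix (x ∷ xs) ys with Segment-prefix xs ys
... | j , u , s , xs≡u = suc j , zero ∷ map suc u , zero ∷ Segment-suc s , refl ∷ shift xs≡u
  where
  shift : ∀ {vs us} → Pointwise (λ v p → v ≡ lookup (xs ++ ys) p) vs us →
          Pointwise (λ v p → v ≡ lookup (x ∷ xs ++ ys) p) vs (map suc us)
  shift []       = []
  shift (e ∷ es) = e ∷ shift es

-- Entries of Parikh matrices as subword counts.

positions : (Δ : OrderedAlphabet A) → Word (Underlying Δ) → List (Fin (size Δ))
positions Δ = map (proj₁ ∘ proj₂)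

-- Upper triangularity. It survives a row operation because the added row comes from one step
-- further down, where column `j` is again below the diagonal.
parikh-below : (Δ : OrderedAlphabet A) (w : Word (Underlying Δ)) {i j : Fin (suc (size Δ))} →
  j < i → parikhMatrix Δ w i j ≡ 0
parikh-below Δ [] {i} {j} j<i rewrite dec-false (i ≟ j) (<⇒≢ j<i ∘ sym) = refl
parikh-below Δ ((_ , q , _) ∷ w) {i} {j} j<i
  rewrite letterMatrix-⊗ q (parikhMatrix Δ w) i j | parikh-below Δ w j<i with i ≟ inject₁ q
... | no _     = refl
... | yes refl = parikh-below Δ w (ℕ.m≤n⇒m≤1+n (subst (toℕ j ℕ.<_) (toℕ-inject₁ q) j<i))

-- Induction on the word: its first letter changes row `inject₁ q` only if it is `q`, the head of
-- the segment, and then the added entry counts the embeddings of the tail.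
parikh-occurrences : (Δ : OrderedAlphabet A) (w : Word (Underlying Δ)) {i j : Fin (suc (size Δ))} →
  ∀ {u} → Segment i j u → parikhMatrix Δ w i j ≡ occurrences u (positions Δ w)
parikh-occurrences Δ [] {i} [] rewrite dec-true (i ≟ i) refl = refl
parikh-occurrences Δ [] {_} {j} (q ∷ s) rewrite dec-false (inject₁ q ≟ j) (<⇒≢ (Segment-< s)) = refl
parikh-occurrences Δ ((_ , p , _) ∷ w) {i} []
  rewrite letterMatrix-⊗ p (parikhMatrix Δ w) i i | parikh-occurrences Δ w {i} [] with i ≟ inject₁ p
... | no _     = refl
-- The added entry, in row `suc p` and column `inject₁ p`, is below the diagonal and vanishes, so
-- the diagonal entry stays 1.
... | yes refl = cong suc (parikh-below Δ w (s≤s (ℕ.≤-reflexive (toℕ-inject₁ p))))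
parikh-occurrences Δ ((_ , p , _) ∷ w) {_} {j} (q ∷ s)
  rewrite letterMatrix-⊗ p (parikhMatrix Δ w) (inject₁ q) j | parikh-occurrences Δ w (q ∷ s)
  with q ≟ p
... | yes refl rewrite dec-true (inject₁ q ≟ inject₁ q) refl =
  cong (_ +_) (parikh-occurrences Δ w s)
... | no q≢p   rewrite dec-false (inject₁ q ≟ inject₁ p) (q≢p ∘ inject₁-injective) = refl

-- Reordering an alphabet.

lookup-injective : {xs : List A} → Unique xs → ∀ {i j} → lookup xs i ≡ lookup xs j → i ≡ j
lookup-injective (_  ∷ _)  {zero}  {zero}  _ = refl
lookup-injective (x∉ ∷ _)  {zero}  {suc j} e = contradiction e (All.lookup x∉ (∈-lookup j))
lookup-injective (x∉ ∷ _)  {suc i} {zero}  e = contradiction (sym e) (All.lookup x∉ (∈-lookup i))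
lookup-injective (_  ∷ xs) {suc i} {suc j} e = cong suc (lookup-injective xs e)

module _ {n : ℕ} where
  open import Data.List.Membership.DecPropositional (_≟_ {n}) public using (_∈?_)

others : List (Fin n) → List (Fin n)
others {n} us = filter (λ x → ¬? (x ∈? us)) (allFin n)

extension-unique : {us : List (Fin n)} → Unique us → Unique (us ++ others us)
extension-unique {n} {us} us! =
  Unique.++⁺ us! (Unique.filter⁺ _ (Unique.allFin⁺ n))
    (λ (x∈us , x∈others) → proj₂ (∈-filter⁻ (λ x → ¬? (x ∈? us)) {xs = allFin n} x∈others) x∈us)

extension-complete : (us : List (Fin n)) (x : Fin n) → x ∈ us ++ others us
extension-complete us x with x ∈? us
... | yes x∈us = ∈-++⁺ˡ x∈us
... | no  x∉us = ∈-++⁺ʳ us (∈-filter⁺ _ (∈-allFin x) x∉us)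

startingWith : (E : OrderedAlphabet A) {us : List (Fin (size E))} → Unique us → OrderedAlphabet A
startingWith E {us} us! = record
  { size             = length (us ++ others us)
  ; letter           = letter E ∘ lookup (us ++ others us)
  ; letter-injective = λ e → lookup-injective (extension-unique us!) (letter-injective E e)
  }

-- Every position of `E` occurs in `us ++ others us`, so the underlying set is unchanged and strong
-- equivalence applies to the new order.
startingWith-≐ : (E : OrderedAlphabet A) {us : List (Fin (size E))} (us! : Unique us) {P : Pred A ℓ} →
  Underlying E ≐ P → Underlying (startingWith E us!) ≐ P
startingWith-≐ E {us} us! (E⊆P , P⊆E) =
  (λ (q , e) → E⊆P (_ , e)) ,
  (λ x∈P → let (p , e) = P⊆E x∈P ; p∈ = extension-complete us p in
    index p∈ , trans (cong (letter E) (sym (lookup-index p∈))) e)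

-- Matching positions of two alphabets.

module _ {a} {A : Set a} where

  Same : (Δ Δ′ : OrderedAlphabet A) → REL (Fin (size Δ)) (Fin (size Δ′)) a
  Same Δ Δ′ q q′ = letter Δ q ≡ letter Δ′ q′

  Same-biUnique : (Δ Δ′ : OrderedAlphabet A) → BiUnique (Same Δ Δ′)
  Same-biUnique Δ Δ′ x≈x′ y≈y′ =
    (λ x≡y → letter-injective Δ′ (trans (sym x≈x′) (trans (cong (letter Δ) x≡y) y≈y′))) ,
    (λ x′≡y′ → letter-injective Δ (trans x≈x′ (trans (cong (letter Δ′) x′≡y′) (sym y≈y′))))

  positions-same : (Δ Δ′ : OrderedAlphabet A) (v : Word (Underlying Δ)) (v′ : Word (Underlying Δ′)) →
    map proj₁ v ≡ map proj₁ v′ → Pointwise (Same Δ Δ′) (positions Δ v) (positions Δ′ v′)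
  positions-same Δ Δ′ [] [] _ = []
  positions-same Δ Δ′ ((_ , _ , e) ∷ v) ((_ , _ , e′) ∷ v′) eq with ∷-injective eq
  ... | x≡x′ , eqs = trans e (trans x≡x′ (sym e′)) ∷ positions-same Δ Δ′ v v′ eqs

inclusion-letters : {P : Pred A ℓ₁} {Q : Pred A ℓ₂} (P⊆Q : P ⊆ Q) (w : Word P) →
  map proj₁ (inclusion {P = P} {Q = Q} P⊆Q w) ≡ map proj₁ w
inclusion-letters P⊆Q w = sym (map-∘ w)

-- A letter found in `vs` inherits its counterpart from `vs′`. Segment letters thus acquire
-- positions in another alphabet by occurring in a word over both.
partners : {R : REL (Fin m) (Fin n) ℓ} {vs : List (Fin m)} {vs′ : List (Fin n)} → Pointwise R vs vs′ →
  ∀ {us} → All (_∈ vs) us → ∃ (Pointwise R us)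
partners vRv′ []         = [] , []
partners {R = R} vRv′ (x∈ ∷ xs) =
  let (x′ , xRx′) = partner vRv′ x∈ ; (xs′ , xsRxs′) = partners vRv′ xs in x′ ∷ xs′ , xRx′ ∷ xsRxs′
  where
  partner : ∀ {vs vs′ x} → Pointwise R vs vs′ → x ∈ vs → ∃ (R x)
  partner (xRx′ ∷ _) (here refl) = _ , xRx′
  partner (_ ∷ rs)   (there x∈)  = partner rs x∈

-- By `BiUnique`, equal partners come from equal letters. Distinctness is what `startingWith` asks
-- of its initial letters.
partners-unique : {R : REL (Fin m) (Fin n) ℓ} → BiUnique R → ∀ {us us′} →
  Pointwise R us us′ → Unique us → Unique us′
partners-unique bi []           _          = []
partners-unique {R = R} bi (r ∷ rs) (x∉ ∷ us!) = fresh rs x∉ ∷ partners-unique bi rs us!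
  where
  fresh : ∀ {vs vs′} → Pointwise R vs vs′ → All (_ ≢_) vs → All (_ ≢_) vs′
  fresh []       []         = []
  fresh (s ∷ ss) (x≢y ∷ x≢) = x≢y ∘ proj₂ (bi r s) ∷ fresh ss x≢

same-startingWith : (Δ E : OrderedAlphabet A) {us′ : List (Fin (size E))} (us′! : Unique us′) →
  ∀ {us vs ws} → Pointwise (Same Δ E) us vs →
  Pointwise (λ x p → x ≡ lookup (us′ ++ others us′) p) vs ws →
  Pointwise (Same Δ (startingWith E us′!)) us ws
same-startingWith Δ E us! []       []       = []
same-startingWith Δ E us! (s ∷ ss) (e ∷ es) = trans s (cong (letter E) e) ∷ same-startingWith Δ E us! ss es

-- Transfer of strong equivalence.

module _ {A : Set a} {P : Pred A ℓ₁} {Q : Pred A ℓ₂} {R : Pred A ℓ₃} (R⊆P : R ⊆ P) (R⊆Q : R ⊆ Q) where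

  -- With `R` for the intersection, the two directions of the equivalence are instances of this
  -- lemma with `P` and `Q` exchanged. Finiteness of `P` supplies the order `E` to be rearranged.
  strong-transfer : Finite P → (w w′ : Word R) →
    StronglyMEquivalent P (inclusion R⊆P w) (inclusion R⊆P w′) →
    StronglyMEquivalent Q (inclusion R⊆Q w) (inclusion R⊆Q w′)
  strong-transfer (E , E≐P) w w′ strong Δ Δ≐Q i j = entries (segment? i j)
    where
    inΔ : Word R → Word (Underlying Δ)
    inΔ v = inclusion (proj₂ Δ≐Q) (inclusion R⊆Q v)

    pos : Word R → List (Fin (size Δ))
    pos v = positions Δ (inΔ v)

    pos-same : (Δ′ : OrderedAlphabet A) (Δ′≐P : Underlying Δ′ ≐ P) (v : Word R) →
      Pointwise (Same Δ Δ′) (pos v) (positions Δ′ (inclusion (proj₂ Δ′≐P) (inclusion R⊆P v)))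
    pos-same Δ′ Δ′≐P v = positions-same Δ Δ′ _ _ (trans
      (trans (inclusion-letters (proj₂ Δ≐Q) (inclusion R⊆Q v)) (inclusion-letters R⊆Q v))
      (sym (trans (inclusion-letters (proj₂ Δ′≐P) (inclusion R⊆P v)) (inclusion-letters R⊆P v))))

    counts : ∀ {u} → Segment i j u → occurrences u (pos w) ≡ occurrences u (pos w′)
    counts {u} s with all? (_∈? (pos w ++ pos w′)) u
    ... | no ¬all = trans (occurrences-absent x∈u (x∉ ∘ ∈-++⁺ˡ))
                          (sym (occurrences-absent x∈u (x∉ ∘ ∈-++⁺ʳ (pos w))))
      where
      absent = ¬All⇒Any¬ (_∈? (pos w ++ pos w′)) u ¬all
      x∈u : Any.lookup absent ∈ u
      x∈u = ∈-lookup (index absent)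
      x∉ : Any.lookup absent ∉ pos w ++ pos w′
      x∉ = lookup-index absent
    ... | yes all = begin
      occurrences u (pos w)                   ≡⟨ occurrences-cong bi u~u₁ (pos-same Δ′ Δ′≐P w) ⟩
      -- Row `zero` is the relevant one, because `Δ′` starts with the letters of `u`.
      occurrences u₁ (positions Δ′ (inΔ′ w))  ≡⟨ parikh-occurrences Δ′ (inΔ′ w) s₁ ⟨
      parikhMatrix Δ′ (inΔ′ w) zero j₁        ≡⟨ strong Δ′ Δ′≐P zero j₁ ⟩
      parikhMatrix Δ′ (inΔ′ w′) zero j₁       ≡⟨ parikh-occurrences Δ′ (inΔ′ w′) s₁ ⟩
      occurrences u₁ (positions Δ′ (inΔ′ w′)) ≡⟨ occurrences-cong bi u~u₁ (pos-same Δ′ Δ′≐P w′) ⟨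
      occurrences u (pos w′)                  ∎
      where
      open ≡-Reasoning
      -- Each letter of `u` occurs in `w` or `w′`, whose letters all have positions in `E`.
      u~E = partners (++⁺ (pos-same E E≐P w) (pos-same E E≐P w′)) all
      u₀ = proj₁ u~E
      u₀! = partners-unique (Same-biUnique Δ E) (proj₂ u~E) (Segment-unique s)
      Δ′ = startingWith E u₀!
      Δ′≐P = startingWith-≐ E u₀! E≐P
      inΔ′ : Word R → Word (Underlying Δ′)
      inΔ′ v = inclusion (proj₂ Δ′≐P) (inclusion R⊆P v)
      prefix = Segment-prefix u₀ (others u₀)
      j₁ = proj₁ prefix
      u₁ = proj₁ (proj₂ prefix)
      s₁ = proj₁ (proj₂ (proj₂ prefix))
      bi = λ {x x′ y y′} → Same-biUnique Δ Δ′ {x} {x′} {y} {y′}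
      u~u₁ = same-startingWith Δ E u₀! (proj₂ u~E) (proj₂ (proj₂ (proj₂ prefix)))

    entries : ∃ (Segment i j) ⊎ j < i → parikhMatrix Δ (inΔ w) i j ≡ parikhMatrix Δ (inΔ w′) i j
    entries (inj₂ j<i)     = trans (parikh-below Δ (inΔ w) j<i) (sym (parikh-below Δ (inΔ w′) j<i))
    entries (inj₁ (_ , s)) =
      trans (parikh-occurrences Δ (inΔ w) s) (trans (counts s) (sym (parikh-occurrences Δ (inΔ w′) s)))

proposition3p4 : {a ℓ₁ ℓ₂ : Level} {A : Set a} (Σ : Pred A ℓ₁) (Γ : Pred A ℓ₂) →
    Finite Σ → Finite Γ →
    (w w′ : Word (Σ ∩ Γ)) →
    StronglyMEquivalent Σ (inclusion proj₁ w) (inclusion proj₁ w′)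
    ⇔ StronglyMEquivalent Γ (inclusion proj₂ w) (inclusion proj₂ w′)
proposition3p4 Σ Γ finΣ finΓ w w′ =
  mk⇔ (strong-transfer {P = Σ} {Q = Γ} proj₁ proj₂ finΣ w w′)
      (strong-transfer {P = Γ} {Q = Σ} proj₂ proj₁ finΓ w w′)
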